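{- For every integer $n\ge 0$, as polynomials in $y$, $$\sum_{k=0}^{n}\det\begin{pmatrix} M_{n,k}(y,y) & M_{n,k+1}(y,y)\\ M_{n+2,k}(y,y) & M_{n+2,k+1}(y,y)\end{pmatrix}=2\,M_{n,0}(y,y)\,M_{n+1,0}(y,y).$$
   Context: A partial Motzkin path from $(0,0)$ to $(n,k)$ is a lattice path that never goes below the $X$-axis and consists of up steps $U=(1,1)$, down steps $D=(1,-1)$ and horizontal steps $H=(1,0)$. In a weighted partial Motzkin path, every up step and every down step has weight $1$, every horizontal step lying on the $X$-axis has weight $x$, and every horizontal step not lying on the $X$-axis has weight $y$; the weight of a path is the product of the weights of its steps. $M_{n,k}(x,y)$ is the sum of the weights of all partial Motzkin paths from $(0,0)$ to $(n,k)$. Equivalently, $M_{0,0}(x,y)=1$, $M_{n,k}(x,y)=0$ if $n<k$ or $k<0$, $M_{n,0}(x,y)=xM_{n-1,0}(x,y)+M_{n-1,1}(x,y)$ for $n\ge1$, and $M_{n,k}(x,y)=M_{n-1,k-1}(x,y)+yM_{n-1,k}(x,y)+M_{n-1,k+1}(x,y)$ for $n\ge k\ge 1$. $M_{n,k}(y,y)$ denotes the polynomial obtained by substituting $x=y$. -}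

module Defs where

open import Algebra.Bundles.Raw using (RawRing)
open import Data.Integer.Base using (+_; +-*-rawRing)
open import Data.List.Base using (List; []; _∷_; _++_; map; foldr; applyUpTo)
open import Data.List.Membership.Propositional using (_∈_)
open import Data.List.Membership.Propositional.Properties
  using (∈-map⁺; ∈-map⁻; ∈-++⁺ˡ; ∈-++⁺ʳ; ∈-++⁻)
open import Data.List.Relation.Binary.Disjoint.Propositional using (Disjoint)
open import Data.List.Relation.Unary.Any using (here)
open import Data.List.Relation.Unary.All using ([])
open import Data.List.Relation.Unary.AllPairs using ([]; _∷_)
open import Data.List.Relation.Unary.Unique.Propositional using (Unique)
open import Data.List.Relation.Unary.Unique.Propositional.Properties
  using (map⁺; ++⁺)
open import Data.Nat.Base using (ℕ; zero; suc)
open import Data.Product.Base using (_,_)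
open import Data.Sum.Base using (inj₁; inj₂)
open import Data.Vec.Base using (Vec; []; _∷_)
open import Level using (0ℓ)
open import Relation.Binary.PropositionalEquality using (refl)

-- Univariate polynomials over R: coefficient lists, constant term first.
-- Trailing zeros are allowed, so equality is coefficientwise.

module Polynomial {c ℓ} (R : RawRing c ℓ) where
  open RawRing R

  Poly : Set c
  Poly = List Carrier

  coeff : Poly → ℕ → Carrier
  coeff []      _       = 0#
  coeff (a ∷ p) zero    = a
  coeff (a ∷ p) (suc i) = coeff p i

  infixl 6 _⊕_
  infixl 7 _⊗_

  _⊕_ : Poly → Poly → Poly
  []      ⊕ q       = q
  (a ∷ p) ⊕ []      = a ∷ p
  (a ∷ p) ⊕ (b ∷ q) = (a + b) ∷ (p ⊕ q)

  _⊗_ : Poly → Poly → Poly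
  []      ⊗ q = []
  (a ∷ p) ⊗ q = map (a *_) q ⊕ (0# ∷ (p ⊗ q))

  rawRing : RawRing c ℓ
  rawRing = record
    { Carrier = Poly
    ; _≈_     = λ p q → ∀ i → coeff p i ≈ coeff q i
    ; _+_     = _⊕_
    ; _*_     = _⊗_
    ; -_      = map (-_)
    ; 0#      = []
    ; 1#      = 1# ∷ []
    }

  const : Carrier → Poly
  const a = a ∷ []

  X : Poly
  X = 0# ∷ 1# ∷ []

  eval : Carrier → Poly → Carrier
  eval a []      = 0#
  eval a (b ∷ p) = b + a * eval a p

-- ℤ[x,y] is realised as (ℤ[y])[x].

ℤ[y] : RawRing 0ℓ 0ℓ
ℤ[y] = Polynomial.rawRing +-*-rawRing

ℤ[x,y] : RawRing 0ℓ 0ℓ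
ℤ[x,y] = Polynomial.rawRing ℤ[y]

y : RawRing.Carrier ℤ[y]
y = Polynomial.X +-*-rawRing

-- Path n k: partial Motzkin paths from (0,0) to (n,k), with the last step
-- outermost. Heights are natural numbers, so no path goes below the X-axis.

data Path : ℕ → ℕ → Set where
  start : Path 0 0
  U     : ∀ {n k} → Path n k       → Path (suc n) (suc k)
  D     : ∀ {n k} → Path n (suc k) → Path (suc n) k
  H     : ∀ {n k} → Path n k       → Path (suc n) k

module _ where
  open RawRing ℤ[x,y]
  private module ℤ[y][x] = Polynomial ℤ[y]

  -- Weight of a horizontal step at the given height.
  horizontal : ℕ → Carrier
  horizontal zero    = ℤ[y][x].X
  horizontal (suc _) = ℤ[y][x].const y

  weight : ∀ {n k} → Path n k → Carrier
  weight start         = 1#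
  weight (U p)         = weight p * 1#
  weight (D p)         = weight p * 1#
  weight (H {k = k} p) = weight p * horizontal k

paths : ∀ n k → List (Path n k)
paths zero    zero    = start ∷ []
paths zero    (suc k) = []
paths (suc n) zero    = map H (paths n zero) ++ map D (paths n 1)
paths (suc n) (suc k) =
  map U (paths n k) ++ map H (paths n (suc k)) ++ map D (paths n (suc (suc k)))

-- Every path occurs in the enumeration, and exactly once.

paths-complete : ∀ {n k} (p : Path n k) → p ∈ paths n k
paths-complete start = here refl
paths-complete (U {n} {k} p) = ∈-++⁺ˡ (∈-map⁺ U (paths-complete p))
paths-complete (D {n} {zero} p) =
  ∈-++⁺ʳ (map H (paths n zero)) (∈-map⁺ D (paths-complete p))
paths-complete (D {n} {suc k} p) =
  ∈-++⁺ʳ (map U (paths n k))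
    (∈-++⁺ʳ (map H (paths n (suc k))) (∈-map⁺ D (paths-complete p)))
paths-complete (H {n} {zero} p) = ∈-++⁺ˡ (∈-map⁺ H (paths-complete p))
paths-complete (H {n} {suc k} p) =
  ∈-++⁺ʳ (map U (paths n k)) (∈-++⁺ˡ (∈-map⁺ H (paths-complete p)))

private
  H-D-disjoint : ∀ {n k} (hs : List (Path n k)) (ds : List (Path n (suc k))) →
                 Disjoint (map H hs) (map D ds)
  H-D-disjoint hs ds (h , d) with ∈-map⁻ H h | ∈-map⁻ D d
  ... | _ , _ , refl | _ , _ , ()

  U-HD-disjoint : ∀ {n k} (us : List (Path n k)) (hs : List (Path n (suc k)))
                  (ds : List (Path n (suc (suc k)))) →
                  Disjoint (map U us) (map H hs ++ map D ds)
  U-HD-disjoint us hs ds (u , hd) with ∈-map⁻ U u | ∈-++⁻ (map H hs) hd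
  ... | _ , _ , refl | inj₁ h with ∈-map⁻ H h
  ...   | _ , _ , ()
  U-HD-disjoint us hs ds (u , hd) | _ , _ , refl | inj₂ d with ∈-map⁻ D d
  ...   | _ , _ , ()

paths-unique : ∀ n k → Unique (paths n k)
paths-unique zero    zero    = [] ∷ []
paths-unique zero    (suc k) = []
paths-unique (suc n) zero    =
  ++⁺ (map⁺ (λ { refl → refl }) (paths-unique n zero))
      (map⁺ (λ { refl → refl }) (paths-unique n 1))
      (H-D-disjoint _ _)
paths-unique (suc n) (suc k) =
  ++⁺ (map⁺ (λ { refl → refl }) (paths-unique n k))
      (++⁺ (map⁺ (λ { refl → refl }) (paths-unique n (suc k)))
           (map⁺ (λ { refl → refl }) (paths-unique n (suc (suc k))))
           (H-D-disjoint _ _))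
      (U-HD-disjoint _ (paths n (suc k)) _)

module Sum {c ℓ} (R : RawRing c ℓ) where
  open RawRing R

  ∑ : List Carrier → Carrier
  ∑ = foldr _+_ 0#

M : ℕ → ℕ → RawRing.Carrier ℤ[x,y]
M n k = Sum.∑ ℤ[x,y] (map weight (paths n k))

M⟨y,y⟩ : ℕ → ℕ → RawRing.Carrier ℤ[y]
M⟨y,y⟩ n k = Polynomial.eval ℤ[y] y (M n k)

open RawRing ℤ[y] public using (_≈_; _*_)
open RawRing ℤ[y] using (Carrier; _+_; -_)

∑[0≤k≤_] : ℕ → (ℕ → Carrier) → Carrier
∑[0≤k≤ n ] f = Sum.∑ ℤ[y] (applyUpTo f (suc n))

det₂ : Vec (Vec Carrier 2) 2 → Carrier
det₂ ((a ∷ b ∷ []) ∷ (c ∷ d ∷ []) ∷ []) = a * d + - (b * c)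

two : Carrier
two = Polynomial.const +-*-rawRing (+ 2)

{-# OPTIONS --safe #-}

-- Put M_{n,-1} = 0. Since both horizontal weights equal y, the recurrence
--   M_{n+1,k} = M_{n,k-1} + y M_{n,k} + M_{n,k+1}
-- then holds for every k ≥ 0, and it makes the sum telescope: with
-- a = M_n and b = M_{n+1}, the k-th determinant is F_k − F_{k+1} for
--   F_k = 2 a_k b_k − (a_{k-1} b_{k+1} + a_{k+1} b_{k-1}).
-- Here F_0 = 2 a_0 b_0 and F_{n+1} = 0, because M_{n,k} = 0 for k > n.

module Submission where

open import Defs using (module Polynomial; module Sum)
open import Algebra.Bundles using (CommutativeRing)
import Algebra.Properties.AbelianGroup as AbelianGroupProperties
import Algebra.Properties.CommutativeSemigroup as CommutativeSemigroupProperties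
import Algebra.Solver.Ring.NaturalCoefficients.Default as SemiringSolver
open import Data.Integer.Properties using (+-*-commutativeRing)
open import Data.List.Base using (List; []; _∷_; _++_; map; applyUpTo)
open import Data.Nat.Base using (ℕ; zero; suc; _<_; s<s)
open import Data.Nat.Properties using (m<n⇒m<1+n; n<1+n)
open import Data.Product.Base using (_,_)
open import Data.Vec.Base using ([]; _∷_)
open import Relation.Binary.PropositionalEquality as ≡ using (_≡_)
import Relation.Binary.Reasoning.Setoid as SetoidReasoning

-- The commutative ring of polynomials over a commutative ring.

module PolynomialProperties {c ℓ} (R : CommutativeRing c ℓ) where
  open CommutativeRing R
  open Polynomial (CommutativeRing.rawRing R) hiding (rawRing)
  open CommutativeSemigroupProperties
    (CommutativeRing.+-commutativeSemigroup R) using (interchange; x∙yz≈y∙xz)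
  open AbelianGroupProperties (CommutativeRing.+-abelianGroup R) using (ε⁻¹≈ε)
  open SetoidReasoning setoid

  private
    infix 4 _≋_
    _≋_ : Poly → Poly → Set ℓ
    p ≋ q = ∀ i → coeff p i ≈ coeff q i

  -- Equality of polynomials sees only coefficients, while `_⊕_` must treat lists of unequal length;
  -- passing to one coefficient turns each law for `_⊕_` into the same law in `R`.
  coeff-⊕ : ∀ p q i → coeff (p ⊕ q) i ≈ coeff p i + coeff q i
  coeff-⊕ []      q       i       = sym (+-identityˡ _)
  coeff-⊕ (a ∷ p) []      i       = sym (+-identityʳ _)
  coeff-⊕ (a ∷ p) (b ∷ q) zero    = refl
  coeff-⊕ (a ∷ p) (b ∷ q) (suc i) = coeff-⊕ p q i

  coeff-scale : ∀ a p i → coeff (map (a *_) p) i ≈ a * coeff p i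
  coeff-scale a []      i       = sym (zeroʳ a)
  coeff-scale a (b ∷ p) zero    = refl
  coeff-scale a (b ∷ p) (suc i) = coeff-scale a p i

  coeff-neg : ∀ p i → coeff (map (-_) p) i ≈ - coeff p i
  coeff-neg []      i       = sym ε⁻¹≈ε
  coeff-neg (b ∷ p) zero    = refl
  coeff-neg (b ∷ p) (suc i) = coeff-neg p i

  -- The recursion (a + Xp)q = aq + X(pq) at a single coefficient: a leading `0#` plays the role of
  -- multiplication by the indeterminate X.
  coeff-∷⊗ : ∀ a p q i →
             coeff ((a ∷ p) ⊗ q) i ≈ a * coeff q i + coeff (0# ∷ p ⊗ q) i
  coeff-∷⊗ a p q i =
    trans (coeff-⊕ (map (a *_) q) _ i) (+-congʳ (coeff-scale a q i))

  ∷-cong : ∀ a {p q} → p ≋ q → a ∷ p ≋ a ∷ q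
  ∷-cong a p≋q zero    = refl
  ∷-cong a p≋q (suc i) = p≋q i

  shift-⊕ : ∀ p q → 0# ∷ p ⊕ q ≋ (0# ∷ p) ⊕ (0# ∷ q)
  shift-⊕ p q zero    = sym (+-identityˡ 0#)
  shift-⊕ p q (suc i) = refl

  shift-scale : ∀ a p → 0# ∷ map (a *_) p ≋ map (a *_) (0# ∷ p)
  shift-scale a p zero    = sym (zeroʳ a)
  shift-scale a p (suc i) = refl

  -- The lists are explicit arguments because `_≋_` unfolds to statements about coefficients, from
  -- which unification cannot recover them.
  ⊕-cong : ∀ p p′ q q′ → p ≋ p′ → q ≋ q′ → p ⊕ q ≋ p′ ⊕ q′
  ⊕-cong p p′ q q′ p≋p′ q≋q′ i = begin
    coeff (p ⊕ q) i           ≈⟨ coeff-⊕ p q i ⟩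
    coeff p i + coeff q i     ≈⟨ +-cong (p≋p′ i) (q≋q′ i) ⟩
    coeff p′ i + coeff q′ i   ≈⟨ coeff-⊕ p′ q′ i ⟨
    coeff (p′ ⊕ q′) i         ∎

  ⊕-assoc : ∀ p q r → (p ⊕ q) ⊕ r ≋ p ⊕ (q ⊕ r)
  ⊕-assoc p q r i = begin
    coeff ((p ⊕ q) ⊕ r) i                 ≈⟨ coeff-⊕ (p ⊕ q) r i ⟩
    coeff (p ⊕ q) i + coeff r i           ≈⟨ +-congʳ (coeff-⊕ p q i) ⟩
    coeff p i + coeff q i + coeff r i     ≈⟨ +-assoc _ _ _ ⟩
    coeff p i + (coeff q i + coeff r i)   ≈⟨ +-congˡ (coeff-⊕ q r i) ⟨
    coeff p i + coeff (q ⊕ r) i           ≈⟨ coeff-⊕ p (q ⊕ r) i ⟨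
    coeff (p ⊕ (q ⊕ r)) i                 ∎

  ⊕-comm : ∀ p q → p ⊕ q ≋ q ⊕ p
  ⊕-comm p q i =
    trans (coeff-⊕ p q i) (trans (+-comm _ _) (sym (coeff-⊕ q p i)))

  ⊕-identityʳ : ∀ p → p ⊕ [] ≋ p
  ⊕-identityʳ p i = trans (coeff-⊕ p [] i) (+-identityʳ _)

  neg-cong : ∀ p q → p ≋ q → map (-_) p ≋ map (-_) q
  neg-cong p q p≋q i =
    trans (coeff-neg p i) (trans (-‿cong (p≋q i)) (sym (coeff-neg q i)))

  ⊕-inverseʳ : ∀ p → p ⊕ map (-_) p ≋ []
  ⊕-inverseʳ p i = begin
    coeff (p ⊕ map (-_) p) i         ≈⟨ coeff-⊕ p (map (-_) p) i ⟩
    coeff p i + coeff (map (-_) p) i ≈⟨ +-congˡ (coeff-neg p i) ⟩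
    coeff p i - coeff p i            ≈⟨ -‿inverseʳ _ ⟩
    0#                               ∎

  ⊕-inverseˡ : ∀ p → map (-_) p ⊕ p ≋ []
  ⊕-inverseˡ p i = trans (⊕-comm (map (-_) p) p i) (⊕-inverseʳ p i)

  ⊗-congˡ : ∀ p q q′ → q ≋ q′ → p ⊗ q ≋ p ⊗ q′
  ⊗-congˡ []      q q′ q≋q′ i = refl
  ⊗-congˡ (a ∷ p) q q′ q≋q′ i = begin
    coeff ((a ∷ p) ⊗ q) i                      ≈⟨ coeff-∷⊗ a p q i ⟩
    a * coeff q i + coeff (0# ∷ p ⊗ q) i
      ≈⟨ +-cong (*-congˡ (q≋q′ i)) (∷-cong 0# (⊗-congˡ p q q′ q≋q′) i) ⟩
    a * coeff q′ i + coeff (0# ∷ p ⊗ q′) i     ≈⟨ coeff-∷⊗ a p q′ i ⟨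
    coeff ((a ∷ p) ⊗ q′) i                     ∎

  ⊗-zeroʳ : ∀ p → p ⊗ [] ≋ []
  ⊗-zeroʳ []      i       = refl
  ⊗-zeroʳ (a ∷ p) zero    = refl
  ⊗-zeroʳ (a ∷ p) (suc i) = ⊗-zeroʳ p i

  -- Mirror image of `coeff-∷⊗`. Since `_⊗_` recurses on its left factor, splitting the right one
  -- takes an induction, in which the two leading products trade places.
  coeff-⊗∷ : ∀ p b q i →
             coeff (p ⊗ (b ∷ q)) i ≈ coeff p i * b + coeff (0# ∷ p ⊗ q) i
  coeff-⊗∷ []      b q zero    = sym (trans (+-identityʳ _) (zeroˡ b))
  coeff-⊗∷ []      b q (suc i) = sym (trans (+-identityʳ _) (zeroˡ b))
  coeff-⊗∷ (a ∷ p) b q zero    = refl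
  coeff-⊗∷ (a ∷ p) b q (suc i) = begin
    coeff ((a ∷ p) ⊗ (b ∷ q)) (suc i)
      ≈⟨ coeff-∷⊗ a p (b ∷ q) (suc i) ⟩
    a * coeff q i + coeff (p ⊗ (b ∷ q)) i
      ≈⟨ +-congˡ (coeff-⊗∷ p b q i) ⟩
    a * coeff q i + (coeff p i * b + coeff (0# ∷ p ⊗ q) i)
      ≈⟨ x∙yz≈y∙xz _ _ _ ⟩
    coeff p i * b + (a * coeff q i + coeff (0# ∷ p ⊗ q) i)
      ≈⟨ +-congˡ (coeff-∷⊗ a p q i) ⟨
    coeff p i * b + coeff ((a ∷ p) ⊗ q) i ∎

  -- Splitting `a ∷ p` off on the left and on the right leads to the same recursion, up to
  -- commutativity in `R`.
  ⊗-comm : ∀ p q → p ⊗ q ≋ q ⊗ p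
  ⊗-comm []      q i = sym (⊗-zeroʳ q i)
  ⊗-comm (a ∷ p) q i = begin
    coeff ((a ∷ p) ⊗ q) i                 ≈⟨ coeff-∷⊗ a p q i ⟩
    a * coeff q i + coeff (0# ∷ p ⊗ q) i
      ≈⟨ +-cong (*-comm _ _) (∷-cong 0# (⊗-comm p q) i) ⟩
    coeff q i * a + coeff (0# ∷ q ⊗ p) i  ≈⟨ coeff-⊗∷ q a p i ⟨
    coeff (q ⊗ (a ∷ p)) i                 ∎

  -- Equal polynomials may be lists of different lengths, which obstructs a direct recursion on the
  -- left factor; commutativity reduces that side to `⊗-congˡ`.
  ⊗-cong : ∀ p p′ q q′ → p ≋ p′ → q ≋ q′ → p ⊗ q ≋ p′ ⊗ q′
  ⊗-cong p p′ q q′ p≋p′ q≋q′ i = begin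
    coeff (p ⊗ q) i   ≈⟨ ⊗-congˡ p q q′ q≋q′ i ⟩
    coeff (p ⊗ q′) i  ≈⟨ ⊗-comm p q′ i ⟩
    coeff (q′ ⊗ p) i  ≈⟨ ⊗-congˡ q′ p p′ p≋p′ i ⟩
    coeff (q′ ⊗ p′) i ≈⟨ ⊗-comm q′ p′ i ⟩
    coeff (p′ ⊗ q′) i ∎

  ⊗-distribˡ-⊕ : ∀ p q r → p ⊗ (q ⊕ r) ≋ p ⊗ q ⊕ p ⊗ r
  ⊗-distribˡ-⊕ []      q r i = refl
  ⊗-distribˡ-⊕ (a ∷ p) q r i = begin
    coeff ((a ∷ p) ⊗ (q ⊕ r)) i
      ≈⟨ coeff-∷⊗ a p (q ⊕ r) i ⟩
    a * coeff (q ⊕ r) i + coeff (0# ∷ p ⊗ (q ⊕ r)) i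
      ≈⟨ +-cong (*-congˡ (coeff-⊕ q r i)) shifted ⟩
    a * (coeff q i + coeff r i) + (coeff (0# ∷ p ⊗ q) i + coeff (0# ∷ p ⊗ r) i)
      ≈⟨ +-congʳ (distribˡ a _ _) ⟩
    a * coeff q i + a * coeff r i + (coeff (0# ∷ p ⊗ q) i + coeff (0# ∷ p ⊗ r) i)
      ≈⟨ interchange _ _ _ _ ⟩
    a * coeff q i + coeff (0# ∷ p ⊗ q) i + (a * coeff r i + coeff (0# ∷ p ⊗ r) i)
      ≈⟨ +-cong (coeff-∷⊗ a p q i) (coeff-∷⊗ a p r i) ⟨
    coeff ((a ∷ p) ⊗ q) i + coeff ((a ∷ p) ⊗ r) i
      ≈⟨ coeff-⊕ ((a ∷ p) ⊗ q) ((a ∷ p) ⊗ r) i ⟨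
    coeff ((a ∷ p) ⊗ q ⊕ (a ∷ p) ⊗ r) i ∎
    where
    shifted : coeff (0# ∷ p ⊗ (q ⊕ r)) i ≈
              coeff (0# ∷ p ⊗ q) i + coeff (0# ∷ p ⊗ r) i
    shifted = begin
      coeff (0# ∷ p ⊗ (q ⊕ r)) i
        ≈⟨ ∷-cong 0# (⊗-distribˡ-⊕ p q r) i ⟩
      coeff (0# ∷ p ⊗ q ⊕ p ⊗ r) i
        ≈⟨ shift-⊕ (p ⊗ q) (p ⊗ r) i ⟩
      coeff ((0# ∷ p ⊗ q) ⊕ (0# ∷ p ⊗ r)) i
        ≈⟨ coeff-⊕ (0# ∷ p ⊗ q) (0# ∷ p ⊗ r) i ⟩
      coeff (0# ∷ p ⊗ q) i + coeff (0# ∷ p ⊗ r) i ∎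

  ⊗-distribʳ-⊕ : ∀ r p q → (p ⊕ q) ⊗ r ≋ p ⊗ r ⊕ q ⊗ r
  ⊗-distribʳ-⊕ r p q i = begin
    coeff ((p ⊕ q) ⊗ r) i
      ≈⟨ ⊗-comm (p ⊕ q) r i ⟩
    coeff (r ⊗ (p ⊕ q)) i
      ≈⟨ ⊗-distribˡ-⊕ r p q i ⟩
    coeff (r ⊗ p ⊕ r ⊗ q) i
      ≈⟨ ⊕-cong (r ⊗ p) (p ⊗ r) (r ⊗ q) (q ⊗ r) (⊗-comm r p) (⊗-comm r q) i ⟩
    coeff (p ⊗ r ⊕ q ⊗ r) i ∎

  scale-⊗ : ∀ a p q → map (a *_) p ⊗ q ≋ map (a *_) (p ⊗ q)
  scale-⊗ a []      q i = refl
  scale-⊗ a (b ∷ p) q i = begin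
    coeff ((a * b ∷ map (a *_) p) ⊗ q) i
      ≈⟨ coeff-∷⊗ (a * b) (map (a *_) p) q i ⟩
    a * b * coeff q i + coeff (0# ∷ map (a *_) p ⊗ q) i
      ≈⟨ +-cong (*-assoc _ _ _) (∷-cong 0# (scale-⊗ a p q) i) ⟩
    a * (b * coeff q i) + coeff (0# ∷ map (a *_) (p ⊗ q)) i
      ≈⟨ +-congˡ (trans (shift-scale a (p ⊗ q) i) (coeff-scale a (0# ∷ p ⊗ q) i)) ⟩
    a * (b * coeff q i) + a * coeff (0# ∷ p ⊗ q) i
      ≈⟨ distribˡ a _ _ ⟨
    a * (b * coeff q i + coeff (0# ∷ p ⊗ q) i)
      ≈⟨ *-congˡ (coeff-∷⊗ b p q i) ⟨
    a * coeff ((b ∷ p) ⊗ q) i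
      ≈⟨ coeff-scale a ((b ∷ p) ⊗ q) i ⟨
    coeff (map (a *_) ((b ∷ p) ⊗ q)) i ∎

  shift-⊗ : ∀ p q → (0# ∷ p) ⊗ q ≋ 0# ∷ p ⊗ q
  shift-⊗ p q i =
    trans (coeff-∷⊗ 0# p q i) (trans (+-congʳ (zeroˡ _)) (+-identityˡ _))

  -- Right distributivity splits `(a ∷ p) ⊗ q` into a scaled and a shifted part. Scaling and
  -- shifting both commute with multiplication by `r`, and the parts recombine by the defining
  -- clause of `_⊗_`.
  ⊗-assoc : ∀ p q r → (p ⊗ q) ⊗ r ≋ p ⊗ (q ⊗ r)
  ⊗-assoc []      q r i = refl
  ⊗-assoc (a ∷ p) q r i = begin
    coeff ((map (a *_) q ⊕ (0# ∷ p ⊗ q)) ⊗ r) i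
      ≈⟨ ⊗-distribʳ-⊕ r (map (a *_) q) (0# ∷ p ⊗ q) i ⟩
    coeff (map (a *_) q ⊗ r ⊕ (0# ∷ p ⊗ q) ⊗ r) i
      ≈⟨ ⊕-cong (map (a *_) q ⊗ r) (map (a *_) (q ⊗ r))
                ((0# ∷ p ⊗ q) ⊗ r) (0# ∷ p ⊗ (q ⊗ r))
                (scale-⊗ a q r)
                (λ j → trans (shift-⊗ (p ⊗ q) r j) (∷-cong 0# (⊗-assoc p q r) j))
                i ⟩
    coeff ((a ∷ p) ⊗ (q ⊗ r)) i ∎

  ⊗-identityˡ : ∀ p → (1# ∷ []) ⊗ p ≋ p
  ⊗-identityˡ p i = begin
    coeff ((1# ∷ []) ⊗ p) i           ≈⟨ coeff-∷⊗ 1# [] p i ⟩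
    1# * coeff p i + coeff (0# ∷ []) i ≈⟨ +-cong (*-identityˡ _) (∷0 i) ⟩
    coeff p i + 0#                    ≈⟨ +-identityʳ _ ⟩
    coeff p i                         ∎
    where
    -- The recursion ends in a trailing zero, so the two lists differ although all their
    -- coefficients agree.
    ∷0 : 0# ∷ [] ≋ []
    ∷0 zero    = refl
    ∷0 (suc i) = refl

  ⊗-identityʳ : ∀ p → p ⊗ (1# ∷ []) ≋ p
  ⊗-identityʳ p i = trans (⊗-comm p (1# ∷ []) i) (⊗-identityˡ p i)

  commutativeRing : CommutativeRing c ℓ
  commutativeRing = record
    { Carrier = Poly
    ; _≈_     = _≋_
    ; _+_     = _⊕_
    ; _*_     = _⊗_
    ; -_      = map (-_)
    ; 0#      = []
    ; 1#      = 1# ∷ []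
    ; isCommutativeRing = record
      { isRing = record
        { +-isAbelianGroup = record
          { isGroup = record
            { isMonoid = record
              { isSemigroup = record
                { isMagma = record
                  { isEquivalence = record
                    { refl  = λ i → refl
                    ; sym   = λ p≋q i → sym (p≋q i)
                    ; trans = λ p≋q q≋r i → trans (p≋q i) (q≋r i)
                    }
                  ; ∙-cong = λ {p p′ q q′} → ⊕-cong p p′ q q′
                  }
                ; assoc = ⊕-assoc
                }
              ; identity = (λ p i → refl) , ⊕-identityʳ
              }
            ; inverse = ⊕-inverseˡ , ⊕-inverseʳ
            ; ⁻¹-cong = λ {p q} → neg-cong p q
            }
          ; comm = ⊕-comm
          }
        ; *-cong     = λ {p p′ q q′} → ⊗-cong p p′ q q′
        ; *-assoc    = ⊗-assoc
        ; *-identity = ⊗-identityˡ , ⊗-identityʳ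
        ; distrib    = ⊗-distribˡ-⊕ , ⊗-distribʳ-⊕
        }
      ; *-comm = ⊗-comm
      }
    }

-- Evaluation of polynomials and of weighted sums over lists.

module Evaluation {c ℓ} (R : CommutativeRing c ℓ) (x : CommutativeRing.Carrier R) where
  open CommutativeRing R
  open Polynomial (CommutativeRing.rawRing R) renaming (rawRing to polyRawRing)
  open Sum polyRawRing
  open CommutativeSemigroupProperties
    (CommutativeRing.+-commutativeSemigroup R) using (interchange)
  open CommutativeSemigroupProperties
    (CommutativeRing.*-commutativeSemigroup R) using (x∙yz≈y∙xz)
  open SetoidReasoning setoid

  eval-⊕ : ∀ p q → eval x (p ⊕ q) ≈ eval x p + eval x q
  eval-⊕ []      q       = sym (+-identityˡ _)
  eval-⊕ (a ∷ p) []      = sym (+-identityʳ _)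
  eval-⊕ (a ∷ p) (b ∷ q) = begin
    a + b + x * eval x (p ⊕ q)              ≈⟨ +-congˡ (*-congˡ (eval-⊕ p q)) ⟩
    a + b + x * (eval x p + eval x q)       ≈⟨ +-congˡ (distribˡ x _ _) ⟩
    a + b + (x * eval x p + x * eval x q)   ≈⟨ interchange _ _ _ _ ⟩
    a + x * eval x p + (b + x * eval x q)   ∎

  eval-scale : ∀ a p → eval x (map (a *_) p) ≈ a * eval x p
  eval-scale a []      = sym (zeroʳ a)
  eval-scale a (b ∷ p) = begin
    a * b + x * eval x (map (a *_) p) ≈⟨ +-congˡ (*-congˡ (eval-scale a p)) ⟩
    a * b + x * (a * eval x p)        ≈⟨ +-congˡ (x∙yz≈y∙xz _ _ _) ⟩
    a * b + a * (x * eval x p)        ≈⟨ distribˡ a _ _ ⟨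
    a * (b + x * eval x p)            ∎

  eval-⊗ : ∀ p q → eval x (p ⊗ q) ≈ eval x p * eval x q
  eval-⊗ []      q = sym (zeroˡ _)
  eval-⊗ (a ∷ p) q = begin
    eval x (map (a *_) q ⊕ (0# ∷ p ⊗ q))
      ≈⟨ eval-⊕ (map (a *_) q) (0# ∷ p ⊗ q) ⟩
    eval x (map (a *_) q) + (0# + x * eval x (p ⊗ q))
      ≈⟨ +-cong (eval-scale a q) (trans (+-identityˡ _) (*-congˡ (eval-⊗ p q))) ⟩
    a * eval x q + x * (eval x p * eval x q)
      ≈⟨ +-congˡ (*-assoc _ _ _) ⟨
    a * eval x q + x * eval x p * eval x q
      ≈⟨ distribʳ _ _ _ ⟨
    (a + x * eval x p) * eval x q ∎

  eval-const : ∀ a → eval x (const a) ≈ a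
  eval-const a = trans (+-congˡ (zeroʳ x)) (+-identityʳ a)

  eval-X : eval x X ≈ x
  eval-X = trans (+-identityˡ _) (trans (*-congˡ (eval-const 1#)) (*-identityʳ x))

  module _ {a} {A : Set a} where

    -- With `weight` and `paths n k` this is `M⟨y,y⟩ n k` by definition. The path recurrence can
    -- therefore be proved after substitution, without the ring laws of `ℤ[x,y]`.
    eval-∑ : (A → Poly) → List A → Carrier
    eval-∑ w ps = eval x (∑ (map w ps))

    eval-∑-++ : ∀ w ps qs → eval-∑ w (ps ++ qs) ≈ eval-∑ w ps + eval-∑ w qs
    eval-∑-++ w []       qs = sym (+-identityˡ _)
    eval-∑-++ w (p ∷ ps) qs = begin
      eval x (w p ⊕ ∑ (map w (ps ++ qs)))
        ≈⟨ eval-⊕ (w p) (∑ (map w (ps ++ qs))) ⟩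
      eval x (w p) + eval-∑ w (ps ++ qs)
        ≈⟨ +-congˡ (eval-∑-++ w ps qs) ⟩
      eval x (w p) + (eval-∑ w ps + eval-∑ w qs)
        ≈⟨ +-assoc _ _ _ ⟨
      eval x (w p) + eval-∑ w ps + eval-∑ w qs
        ≈⟨ +-congʳ (eval-⊕ (w p) (∑ (map w ps))) ⟨
      eval-∑ w (p ∷ ps) + eval-∑ w qs ∎

  -- Here `f` models appending a step of weight `s`: every summand gains the same factor, which
  -- evaluation pulls out of the sum. The separate `e` lets the result mention the simplified value
  -- of `s`.
  eval-∑-map : ∀ {a b} {A : Set a} {B : Set b}
               (v : B → Poly) (f : A → B) (w : A → Poly) s {e} → eval x s ≈ e →
               (∀ p → v (f p) ≡ w p ⊗ s) →
               ∀ ps → eval-∑ v (map f ps) ≈ e * eval-∑ w ps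
  eval-∑-map v f w s {e} s≈e v∘f≡w⊗s []       = sym (zeroʳ e)
  eval-∑-map v f w s {e} s≈e v∘f≡w⊗s (p ∷ ps) = begin
    eval x (v (f p) ⊕ ∑ (map v (map f ps)))
      ≈⟨ eval-⊕ (v (f p)) _ ⟩
    eval x (v (f p)) + eval-∑ v (map f ps)
      ≈⟨ +-cong (reflexive (≡.cong (eval x) (v∘f≡w⊗s p)))
                (eval-∑-map v f w s s≈e v∘f≡w⊗s ps) ⟩
    eval x (w p ⊗ s) + e * eval-∑ w ps
      ≈⟨ +-congʳ (eval-⊗ (w p) s) ⟩
    eval x (w p) * eval x s + e * eval-∑ w ps
      ≈⟨ +-congʳ (trans (*-congˡ s≈e) (*-comm _ _)) ⟩
    e * eval x (w p) + e * eval-∑ w ps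
      ≈⟨ distribˡ e _ _ ⟨
    e * (eval x (w p) + eval-∑ w ps)
      ≈⟨ *-congˡ (eval-⊕ (w p) (∑ (map w ps))) ⟨
    e * eval-∑ w (p ∷ ps) ∎

  -- `g` models a horizontal step and `h` a down step. Asking only that `s` evaluate to `x` covers
  -- both `X` (on the axis) and `const x` (above it); this is where the substitution merges the two
  -- horizontal weights.
  module _ {a b} {B : Set b} {A₁ A₂ : Set a} (v : B → Poly)
           {g : A₁ → B} (w₁ : A₁ → Poly) s (s≈x : eval x s ≈ x)
           (v∘g : ∀ p → v (g p) ≡ w₁ p ⊗ s)
           {h : A₂ → B} (w₂ : A₂ → Poly) (v∘h : ∀ p → v (h p) ≡ w₂ p ⊗ const 1#)
           where

    eval-∑-map₂ : ∀ ps qs → eval-∑ v (map g ps ++ map h qs) ≈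
                            x * eval-∑ w₁ ps + eval-∑ w₂ qs
    eval-∑-map₂ ps qs = begin
      eval-∑ v (map g ps ++ map h qs)
        ≈⟨ eval-∑-++ v (map g ps) (map h qs) ⟩
      eval-∑ v (map g ps) + eval-∑ v (map h qs)
        ≈⟨ +-cong (eval-∑-map v g w₁ s s≈x v∘g ps)
                  (eval-∑-map v h w₂ (const 1#) (eval-const 1#) v∘h qs) ⟩
      x * eval-∑ w₁ ps + 1# * eval-∑ w₂ qs
        ≈⟨ +-congˡ (*-identityˡ _) ⟩
      x * eval-∑ w₁ ps + eval-∑ w₂ qs ∎

    eval-∑-map₃ : ∀ {A₀ : Set a} {f : A₀ → B} (w₀ : A₀ → Poly) →
                  (∀ p → v (f p) ≡ w₀ p ⊗ const 1#) → ∀ os ps qs →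
                  eval-∑ v (map f os ++ map g ps ++ map h qs) ≈
                  eval-∑ w₀ os + (x * eval-∑ w₁ ps + eval-∑ w₂ qs)
    eval-∑-map₃ {f = f} w₀ v∘f os ps qs = begin
      eval-∑ v (map f os ++ map g ps ++ map h qs)
        ≈⟨ eval-∑-++ v (map f os) (map g ps ++ map h qs) ⟩
      eval-∑ v (map f os) + eval-∑ v (map g ps ++ map h qs)
        ≈⟨ +-cong (eval-∑-map v f w₀ (const 1#) (eval-const 1#) v∘f os)
                  (eval-∑-map₂ ps qs) ⟩
      1# * eval-∑ w₀ os + (x * eval-∑ w₁ ps + eval-∑ w₂ qs)
        ≈⟨ +-congʳ (*-identityˡ _) ⟩
      eval-∑ w₀ os + (x * eval-∑ w₁ ps + eval-∑ w₂ qs) ∎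

-- The telescoping sum of determinants.

module Telescoping {c ℓ} (R : CommutativeRing c ℓ) where
  open CommutativeRing R
  open Sum (CommutativeRing.rawRing R)
  open AbelianGroupProperties (CommutativeRing.+-abelianGroup R)
    using (⁻¹-∙-comm; ⁻¹-anti-homo‿-; ε⁻¹≈ε)
  open CommutativeSemigroupProperties
    (CommutativeRing.+-commutativeSemigroup R) using (interchange)
  open SetoidReasoning setoid

  -- Allows the determinant identity to be proved in a subtraction-free form, within reach of a
  -- solver for commutative semirings.
  cross-sum⇒difference : ∀ u v s t → u + t ≈ v + s → u - v ≈ s - t
  cross-sum⇒difference u v s t u+t≈v+s = begin
    u - v                 ≈⟨ +-identityʳ _ ⟨
    u - v + 0#            ≈⟨ +-congˡ (-‿inverseʳ t) ⟨
    u - v + (t - t)       ≈⟨ interchange _ _ _ _ ⟩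
    u + t + (- v - t)     ≈⟨ +-congʳ u+t≈v+s ⟩
    v + s + (- v - t)     ≈⟨ interchange _ _ _ _ ⟩
    v - v + (s - t)       ≈⟨ +-congʳ (-‿inverseʳ v) ⟩
    0# + (s - t)          ≈⟨ +-identityˡ _ ⟩
    s - t                 ∎

  difference-interchange : ∀ p q p′ q′ →
                           (p + q′) - (q + p′) ≈ (p - q) - (p′ - q′)
  difference-interchange p q p′ q′ = begin
    (p + q′) - (q + p′)     ≈⟨ +-congˡ (⁻¹-∙-comm q p′) ⟨
    (p + q′) + (- q - p′)   ≈⟨ interchange _ _ _ _ ⟩
    (p - q) + (q′ - p′)     ≈⟨ +-congˡ (⁻¹-anti-homo‿- p′ q′) ⟨
    (p - q) - (p′ - q′)     ∎

  x-0≈x : ∀ {x z} → z ≈ 0# → x - z ≈ x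
  x-0≈x z≈0 = trans (+-congˡ (trans (-‿cong z≈0) ε⁻¹≈ε)) (+-identityʳ _)

  -- `applyUpTo` exposes the first term, so the induction runs on the shifted sequences and the two
  -- copies of `F 1` cancel.
  telescope : ∀ (d F : ℕ → Carrier) → (∀ k → d k ≈ F k - F (suc k)) →
              ∀ m → ∑ (applyUpTo d m) ≈ F 0 - F m
  telescope d F step zero    = sym (-‿inverseʳ (F 0))
  telescope d F step (suc m) = begin
    d 0 + ∑ (applyUpTo (λ k → d (suc k)) m)
      ≈⟨ +-cong (step 0)
                (telescope (λ k → d (suc k)) (λ k → F (suc k)) (λ k → step (suc k)) m) ⟩
    F 0 - F 1 + (F 1 - F (suc m))    ≈⟨ +-assoc _ _ _ ⟩
    F 0 + (- F 1 + (F 1 - F (suc m))) ≈⟨ +-congˡ (+-assoc _ _ _) ⟨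
    F 0 + (- F 1 + F 1 - F (suc m))  ≈⟨ +-congˡ (+-congʳ (-‿inverseˡ (F 1))) ⟩
    F 0 + (0# - F (suc m))           ≈⟨ +-congˡ (+-identityˡ _) ⟩
    F 0 - F (suc m)                  ∎

  -- Column k ≥ −1 of a row is stored at index k + 1.
  module _ (y : Carrier) (a b c : ℕ → Carrier)
           (b-rec : ∀ k → b (suc k) ≈ a k + (y * a (suc k) + a (suc (suc k))))
           (c-rec : ∀ k → c (suc k) ≈ b k + (y * b (suc k) + b (suc (suc k))))
           where

    private
      -- The positive and negative parts of F_k, with column indices raised by one. Keeping them
      -- apart avoids subtraction in the algebraic identity.
      P Q : ℕ → Carrier
      P k = (1# + 1#) * a (suc k) * b (suc k)
      Q k = a k * b (suc (suc k)) + a (suc (suc k)) * b k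

      open SemiringSolver (CommutativeRing.commutativeSemiring R)
        using (solve; _:+_; _:*_; _:=_; con)

    -- After expanding c, both sides agree up to terms b_{k+1} b_k and
    -- b_k b_{k+1}, each with one factor expanded by b-rec.
    det-cross-sum : ∀ k →
      a (suc k) * c (suc (suc k)) + (Q k + P (suc k)) ≈
      a (suc (suc k)) * c (suc k) + (P k + Q (suc k))
    det-cross-sum k = begin
      a₁ * c (suc (suc k)) + (Q k + P (suc k))
        ≈⟨ +-congʳ (*-congˡ (c-rec (suc k))) ⟩
      a₁ * (b₁ + (y * b₂ + b₃)) + (Q k + P (suc k))
        ≈⟨ solve 8 (λ y a₀ a₁ a₂ b₀ b₁ b₂ b₃ →
             a₁ :* (b₁ :+ (y :* b₂ :+ b₃)) :+
               (a₀ :* b₂ :+ a₂ :* b₀ :+ (con 1 :+ con 1) :* a₂ :* b₂) :=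
             a₁ :* b₁ :+ a₁ :* b₃ :+ a₂ :* b₀ :+ a₂ :* b₂ :+
               b₂ :* (a₀ :+ (y :* a₁ :+ a₂)))
             refl y a₀ a₁ a₂ b₀ b₁ b₂ b₃ ⟩
      rest + b₂ * (a₀ + (y * a₁ + a₂))
        ≈⟨ +-congˡ (*-congˡ (b-rec k)) ⟨
      rest + b₂ * b₁
        ≈⟨ +-congˡ (*-comm b₂ b₁) ⟩
      rest + b₁ * b₂
        ≈⟨ +-congˡ (*-congˡ (b-rec (suc k))) ⟩
      rest + b₁ * (a₁ + (y * a₂ + a₃))
        ≈⟨ solve 8 (λ y a₁ a₂ a₃ b₀ b₁ b₂ b₃ →
             a₁ :* b₁ :+ a₁ :* b₃ :+ a₂ :* b₀ :+ a₂ :* b₂ :+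
               b₁ :* (a₁ :+ (y :* a₂ :+ a₃)) :=
             a₂ :* (b₀ :+ (y :* b₁ :+ b₂)) :+
               ((con 1 :+ con 1) :* a₁ :* b₁ :+ (a₁ :* b₃ :+ a₃ :* b₁)))
             refl y a₁ a₂ a₃ b₀ b₁ b₂ b₃ ⟩
      a₂ * (b₀ + (y * b₁ + b₂)) + (P k + Q (suc k))
        ≈⟨ +-congʳ (*-congˡ (c-rec k)) ⟨
      a₂ * c (suc k) + (P k + Q (suc k)) ∎
      where
      a₀ = a k ; a₁ = a (suc k) ; a₂ = a (suc (suc k)) ; a₃ = a (suc (suc (suc k)))
      b₀ = b k ; b₁ = b (suc k) ; b₂ = b (suc (suc k)) ; b₃ = b (suc (suc (suc k)))
      rest = a₁ * b₁ + a₁ * b₃ + a₂ * b₀ + a₂ * b₂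

    -- The sum collapses to F_0 - F_m, with `m` the number of terms. The zeros in column -1 remove
    -- `Q 0`, those in columns m and m + 1 remove F_m, and only `P 0` survives.
    ∑-det : ∀ m → a 0 ≈ 0# → b 0 ≈ 0# →
            a (suc m) ≈ 0# → a (suc (suc m)) ≈ 0# → b (suc (suc m)) ≈ 0# →
            ∑ (applyUpTo (λ k → a (suc k) * c (suc (suc k)) -
                                a (suc (suc k)) * c (suc k)) m) ≈
            (1# + 1#) * a 1 * b 1
    ∑-det m a₀≈0 b₀≈0 aₘ≈0 aₘ₊₁≈0 bₘ₊₁≈0 = begin
      ∑ (applyUpTo _ m)            ≈⟨ telescope _ (λ k → P k - Q k) det≈ m ⟩
      (P 0 - Q 0) - (P m - Q m)    ≈⟨ x-0≈x (trans (x-0≈x Qₘ≈0) Pₘ≈0) ⟩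
      P 0 - Q 0                    ≈⟨ x-0≈x Q₀≈0 ⟩
      P 0                          ∎
      where
      det≈ : ∀ k → a (suc k) * c (suc (suc k)) - a (suc (suc k)) * c (suc k) ≈
                   (P k - Q k) - (P (suc k) - Q (suc k))
      det≈ k = trans (cross-sum⇒difference _ _ _ _ (det-cross-sum k))
                     (difference-interchange _ _ _ _)

      zero*ˡ : ∀ {u v} → u ≈ 0# → u * v ≈ 0#
      zero*ˡ u≈0 = trans (*-congʳ u≈0) (zeroˡ _)

      zero*ʳ : ∀ {u v} → v ≈ 0# → u * v ≈ 0#
      zero*ʳ v≈0 = trans (*-congˡ v≈0) (zeroʳ _)

      -- The factor from `a` has to vanish here: in the application m = n + 1, and column n + 1 of
      -- row n + 1 contains 1, the weight of the path with up steps only.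
      Pₘ≈0 : P m ≈ 0#
      Pₘ≈0 = zero*ˡ (zero*ʳ aₘ≈0)

      Qₘ≈0 : Q m ≈ 0#
      Qₘ≈0 = trans (+-cong (zero*ʳ bₘ₊₁≈0) (zero*ˡ aₘ₊₁≈0)) (+-identityʳ 0#)

      Q₀≈0 : Q 0 ≈ 0#
      Q₀≈0 = trans (+-cong (zero*ˡ a₀≈0) (zero*ʳ b₀≈0)) (+-identityʳ 0#)

-- Motzkin rows at `x = y` and the determinant identity.

open import Defs

-- Its operations and equality are definitionally those of `ℤ[y]`, so the general lemmas apply to
-- `M⟨y,y⟩` without conversion.
ℤ[y]-commutativeRing : CommutativeRing _ _
ℤ[y]-commutativeRing = PolynomialProperties.commutativeRing +-*-commutativeRing

open CommutativeRing ℤ[y]-commutativeRing using (Carrier; _+_; 0#)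
open Evaluation ℤ[y]-commutativeRing y using (eval-∑-map₂; eval-∑-map₃; eval-X; eval-const)

-- A step raises the height by at most one: a path ending too high would extend one that ends at
-- height `k`, `suc k` or `suc (suc k)`, again too high for its length.
paths-empty : ∀ {n k} → n < k → paths n k ≡ []
paths-empty {zero}  {suc k} _         = ≡.refl
paths-empty {suc n} {suc k} (s<s n<k)
  rewrite paths-empty n<k
        | paths-empty (m<n⇒m<1+n n<k)
        | paths-empty (m<n⇒m<1+n (m<n⇒m<1+n n<k)) = ≡.refl

row : ℕ → ℕ → Carrier
row n zero    = 0#
row n (suc k) = M⟨y,y⟩ n k

row-empty : ∀ {n k} → n < k → row n (suc k) ≈ 0#
row-empty n<k i rewrite paths-empty n<k = ≡.refl

row-rec : ∀ n k → row (suc n) (suc k) ≈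
                  row n k + (y * row n (suc k) + row n (suc (suc k)))
-- Column -1 contributes `0#`, which is `[]`, and `[] ⊕ q` reduces to `q`; hence the two-term
-- formula already has the required form.
row-rec n zero    = eval-∑-map₂ weight weight _ eval-X (λ _ → ≡.refl)
                      weight (λ _ → ≡.refl) (paths n 0) (paths n 1)
row-rec n (suc k) = eval-∑-map₃ weight weight _ (eval-const y) (λ _ → ≡.refl)
                      weight (λ _ → ≡.refl) weight (λ _ → ≡.refl)
                      (paths n k) (paths n (suc k)) (paths n (suc (suc k)))

theorem3p11 : (n : ℕ) →
    ∑[0≤k≤ n ] (λ k → det₂ ((M⟨y,y⟩ n k ∷ M⟨y,y⟩ n (suc k) ∷ []) ∷
    (M⟨y,y⟩ (suc (suc n)) k ∷ M⟨y,y⟩ (suc (suc n)) (suc k) ∷ []) ∷ []))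
    ≈ two * M⟨y,y⟩ n 0 * M⟨y,y⟩ (suc n) 0
theorem3p11 n =
  -- The sum from 0 to n has `suc n` terms, and `1# + 1#` computes to `two`. The vanishing entries
  -- are columns n + 1 and n + 2 of row n, and column n + 2 of row n + 1.
  ∑-det y (row n) (row (suc n)) (row (suc (suc n)))
    (row-rec n) (row-rec (suc n)) (suc n)
    (λ _ → ≡.refl) (λ _ → ≡.refl)
    (row-empty (n<1+n n)) (row-empty (m<n⇒m<1+n (n<1+n n))) (row-empty (n<1+n (suc n)))
  where open Telescoping ℤ[y]-commutativeRing
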